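{- Let $G$ be a graph of order $n(G)$. \begin{itemize} \item[(i)] If $\gamma_{\rm MBT}(G) <\infty$, then $\gamma_{\rm MBT}(G) \leq \left\lceil\frac{n(G)}{2}\right\rceil$. \item[(ii)] If $\gamma_{\rm MBT}'(G) < \infty$, then $\gamma_{\rm MBT}'(G) \leq \left\lfloor\frac{n(G)}{2}\right\rfloor$. \end{itemize} Moreover, for any integer $k > 1$, there is a connected graph $H$ with $\gamma_{\rm MBT}(H) = k = \left\lceil\frac{n(H)}{2}\right\rceil$, and there is a connected graph $H'$ with $\gamma_{\rm MBT}'(H')=k=\left\lfloor\frac{n(H')}{2}\right\rfloor$.
   Context: All graphs are finite and simple; $n(G)$ denotes the number of vertices of $G$. A set $D\subseteq V(G)$ is a total dominating set if every vertex of $G$ has a neighbor in $D$. The Maker-Breaker total domination (MBTD) game on $G$ is played by two players, Dominator and Staller, who alternately select previously unselected vertices of $G$; Dominator wins if the set of vertices he has selected contains a total dominating set of $G$, and Staller wins if this never happens (i.e., she selects a vertex of every total dominating set). In the D-game Dominator makes the first move; in the S-game Staller makes the first move. The Maker-Breaker total domination number $\gamma_{\rm MBT}(G)$ is the minimum number of moves Dominator needs to win the D-game (Dominator trying to win as fast as possible, Staller trying to prevent or delay his win, both playing optimally), with $\gamma_{\rm MBT}(G)=\infty$ if Dominator has no winning strategy in the D-game. The Staller-start Maker-Breaker total domination number $\gamma_{\rm MBT}'(G)$ is defined in the same way for the S-game. -}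

module Defs where

open import Data.Nat using (ℕ; zero; suc; _<_)
open import Data.Fin using (Fin; _≟_)
open import Data.Product using (Σ; _×_)
open import Data.Sum using (_⊎_)
open import Relation.Nullary using (¬_; yes; no)
open import Relation.Binary.PropositionalEquality using (_≡_)

record Graph (n : ℕ) : Set₁ where
  field
    Adj   : Fin n → Fin n → Set
    sym   : ∀ {u v} → Adj u v → Adj v u
    irrefl : ∀ {v} → ¬ Adj v v
open Graph public

data Reach {n : ℕ} (G : Graph n) : Fin n → Fin n → Set where
  here : ∀ {v} → Reach G v v
  step : ∀ {u w v} → Adj G u w → Reach G w v → Reach G u v

Connected : ∀ {n} → Graph n → Set
Connected {n} G = ∀ (u v : Fin n) → Reach G u v

data Owner : Set where
  free dom stal : Owner

Position : ℕ → Set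
Position n = Fin n → Owner

start : ∀ {n} → Position n
start _ = free

update : ∀ {n} → Position n → Fin n → Owner → Position n
update p v o w with w ≟ v
... | yes _ = o
... | no  _ = p w

TotDom : ∀ {n} → Graph n → Position n → Set
TotDom {n} G p = ∀ (v : Fin n) → Σ (Fin n) λ u → Adj G v u × p u ≡ dom

-- DTurn G k p : Dominator, to move in position p, can force a win
-- using at most k further moves of his own.
-- STurn G k p : same, but Staller is to move in position p.
-- Staller must move if a vertex is free; if no vertex is free and
-- Dominator has not won, the game is over and Staller has won.
DTurn : ∀ {n} → Graph n → ℕ → Position n → Set
STurn : ∀ {n} → Graph n → ℕ → Position n → Set
DTurn G zero    p = TotDom G p
DTurn {n} G (suc k) p =
  TotDom G p ⊎ Σ (Fin n) λ v → p v ≡ free × STurn G k (update p v dom)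
STurn {n} G k p =
  TotDom G p ⊎
  (Σ (Fin n) (λ v → p v ≡ free) ×
   (∀ (v : Fin n) → p v ≡ free → DTurn G k (update p v stal)))

IsLeast : (ℕ → Set) → ℕ → Set
IsLeast P k = P k × (∀ j → j < k → ¬ P j)

γMBT≡ : ∀ {n} → Graph n → ℕ → Set
γMBT≡ G k = IsLeast (λ j → DTurn G j start) k

γ'MBT≡ : ∀ {n} → Graph n → ℕ → Set
γ'MBT≡ G k = IsLeast (λ j → STurn G j start) k

{-# OPTIONS --safe #-}
-- Upper bounds: every move uses up a free vertex, so a winning strategy from a
-- position with f free vertices needs at most ⌈f/2⌉ (Dominator to move) or ⌊f/2⌋
-- (Staller to move) moves of Dominator.
--
-- Sharpness: disjoint free pairs such that every undominated vertex has some pair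
-- inside its neighbourhood give a pairing strategy with one move per pair, while the
-- total domination number bounds the length of any win from below. Both numbers equal
-- k for the 4-cycle (k = 2, either game) and, when k = 3, for a graph on 6 vertices
-- (D-game) and one on 7 vertices (S-game). Hanging a 4-cycle by an edge at a fixed
-- root adds 4 vertices, 2 pairs, and 2 to the total domination number.
module Submission where

open import Defs
open import Data.Bool using (Bool)
open import Data.Fin using (Fin; zero; suc; _≟_; _↑ʳ_; splitAt)
open import Data.Fin.Patterns
open import Data.Fin.Properties using (all?; any?; ↑ʳ-injective)
open import Data.Fin.Subset using (Subset; _∈_; ∣_∣; ⊤; ⊥; _∪_; ⁅_⁆; _-_; inside; outside)
open import Data.Fin.Subset.Properties
  using (_∈?_; anySubset?; ∈⊤; ∣⊤∣≡n; ∣⊥∣≡0; ∣⁅x⁆∣≡1; ∣p∣≤∣x∷p∣; x∈p⇒∣p-x∣<∣p∣;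
         x∈p∧x≢y⇒x∈p-y; x∈p∪q⁺; x∈⁅x⁆)
open import Data.List using (List; []; _∷_; _++_; length; map)
open import Data.List.Membership.Propositional using () renaming (_∈_ to _∈ₗ_)
open import Data.List.Properties using (length-map; map-++)
open import Data.List.Relation.Binary.Permutation.Propositional
  using (_↭_; ↭⇒↭ₛ; prep; swap; refl; trans; module PermutationReasoning)
open import Data.List.Relation.Binary.Permutation.Propositional.Properties
  using (↭-length; All-resp-↭; Any-resp-↭; shifts)
import Data.List.Relation.Binary.Permutation.Setoid.Properties as Permutationₛ
open import Data.List.Relation.Unary.All as All using (All; []; _∷_)
import Data.List.Relation.Unary.All.Properties as All
open import Data.List.Relation.Unary.AllPairs using ([]; _∷_)
open import Data.List.Relation.Unary.Any as Any using (Any; here; there)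
import Data.List.Relation.Unary.Any.Properties as Any
open import Data.List.Relation.Unary.Unique.Propositional using (Unique)
import Data.List.Relation.Unary.Unique.Propositional.Properties as Unique
open import Data.Nat using (ℕ; zero; suc; _+_; _≤_; _<_; ⌈_/2⌉; ⌊_/2⌋; z≤n; s≤s; _<?_)
open import Data.Nat.Properties
  using (≤-trans; ≤-reflexive; ≮⇒≥; <⇒≱; m≤n+m; +-suc; +-comm; +-identityʳ; +-monoʳ-≤;
         suc-injective; module ≤-Reasoning)
open import Data.Product using (Σ; _×_; _,_; proj₁; proj₂)
open import Data.Sum using (_⊎_; inj₁; inj₂; [_,_]′; fromInj₁)
  renaming (map to ⊎-map; map₁ to ⊎-map₁)
open import Data.Vec using ([]; _∷_; here; there)
open import Function using (_∘_; id)
open import Relation.Binary.PropositionalEquality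
  using (_≡_; _≢_; refl; cong; subst; setoid) renaming (sym to ≡-sym; trans to ≡-trans)
open import Relation.Nullary
  using (Dec; ¬_; yes; no; contradiction; ¬?; _×-dec_; _→-dec_; _⊎-dec_)
open import Relation.Nullary.Decidable using (True; False; toWitness; toWitnessFalse)

private variable
  n : ℕ

-- Positions after a move

update-≡ : (p : Position n) (v : Fin n) (o : Owner) → update p v o v ≡ o
update-≡ p v o with v ≟ v
... | yes _   = refl
... | no  v≢v = contradiction refl v≢v

update-≢ : (p : Position n) {v w : Fin n} (o : Owner) → w ≢ v → update p v o w ≡ p w
update-≢ p {v} {w} o w≢v with w ≟ v
... | yes w≡v = contradiction w≡v w≢v
... | no  _   = refl

update⁻ : (p : Position n) (v : Fin n) (o : Owner) (w : Fin n) {o′ : Owner} →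
          update p v o w ≡ o′ → w ≡ v × o ≡ o′ ⊎ w ≢ v × p w ≡ o′
update⁻ p v o w eq with w ≟ v
... | yes w≡v = inj₁ (w≡v , eq)
... | no  w≢v = inj₂ (w≢v , eq)

distinct : {p : Position n} {v w : Fin n} {o o′ : Owner} → p v ≡ o → p w ≡ o′ → o ≢ o′ → v ≢ w
distinct pv pw o≢o′ refl = o≢o′ (≡-trans (≡-sym pv) pw)

-- Upper bounds

TotDom⇒DTurn : {G : Graph n} (k : ℕ) {p : Position n} → TotDom G p → DTurn G k p
TotDom⇒DTurn zero    td = td
TotDom⇒DTurn (suc k) td = inj₁ td

-- A position is a function, so its free vertices are counted through a `Subset` containing them; an
-- upper bound is all that the halving argument needs.
Free⊆ : Position n → Subset n → Set
Free⊆ {n} p F = (v : Fin n) → p v ≡ free → v ∈ F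

Free⊆-update : {p : Position n} {F : Subset n} (v : Fin n) {o : Owner} → o ≢ free →
               Free⊆ p F → Free⊆ (update p v o) (F - v)
Free⊆-update {p = p} {F} v {o} o≢free F⊇ w eq with update⁻ p v o w eq
... | inj₁ (_ , o≡free)   = contradiction o≡free o≢free
... | inj₂ (w≢v , pw≡free) = x∈p∧x≢y⇒x∈p-y (F⊇ w pw≡free) w≢v

∣F-v∣≤ : {F : Subset n} {v : Fin n} {f : ℕ} → v ∈ F → ∣ F ∣ ≤ suc f → ∣ F - v ∣ ≤ f
∣F-v∣≤ v∈F ∣F∣≤ with s≤s le ← ≤-trans (x∈p⇒∣p-x∣<∣p∣ v∈F) ∣F∣≤ = le

∣F∣≰0 : {F : Subset n} {v : Fin n} {A : Set} → v ∈ F → ∣ F ∣ ≤ 0 → A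
∣F∣≰0 v∈F ∣F∣≤0 with () ← ≤-trans (x∈p⇒∣p-x∣<∣p∣ v∈F) ∣F∣≤0

-- The strategy is kept and only its move budget is recounted. Each move deletes a vertex from `F`,
-- and the budgets match by computation: `⌈ suc f /2⌉` is `suc ⌊ f /2⌋`, and `⌊ suc f /2⌋` is
-- `⌈ f /2⌉`.
DTurn-half : (G : Graph n) (k f : ℕ) {p : Position n} {F : Subset n} →
             Free⊆ p F → ∣ F ∣ ≤ f → DTurn G k p → DTurn G ⌈ f /2⌉ p
STurn-half : (G : Graph n) (k f : ℕ) {p : Position n} {F : Subset n} →
             Free⊆ p F → ∣ F ∣ ≤ f → STurn G k p → STurn G ⌊ f /2⌋ p
DTurn-half G zero    f F⊇ le td = TotDom⇒DTurn ⌈ f /2⌉ td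
DTurn-half G (suc k) f F⊇ le (inj₁ td) = TotDom⇒DTurn ⌈ f /2⌉ td
DTurn-half G (suc k) zero F⊇ le (inj₂ (v , fv , _)) = ∣F∣≰0 (F⊇ v fv) le
DTurn-half G (suc k) (suc f) F⊇ le (inj₂ (v , fv , s)) =
  inj₂ (v , fv , STurn-half G k f (Free⊆-update v (λ ()) F⊇) (∣F-v∣≤ (F⊇ v fv) le) s)
STurn-half G k f F⊇ le (inj₁ td) = inj₁ td
STurn-half G k zero F⊇ le (inj₂ ((v , fv) , _)) = ∣F∣≰0 (F⊇ v fv) le
STurn-half G k (suc f) F⊇ le (inj₂ (∃free , d)) = inj₂ (∃free , λ v fv →
  DTurn-half G k f (Free⊆-update v (λ ()) F⊇) (∣F-v∣≤ (F⊇ v fv) le) (d v fv))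

least≤ : {P : ℕ → Set} {k m : ℕ} → IsLeast P k → P m → k ≤ m
least≤ (_ , least) Pm = ≮⇒≥ (λ m<k → least _ m<k Pm)

γMBT≤⌈n/2⌉ : (n : ℕ) (G : Graph n) (k : ℕ) → γMBT≡ G k → k ≤ ⌈ n /2⌉
γMBT≤⌈n/2⌉ n G k γ =
  least≤ γ (DTurn-half G k n {F = ⊤} (λ _ _ → ∈⊤) (≤-reflexive (∣⊤∣≡n n)) (proj₁ γ))

γ'MBT≤⌊n/2⌋ : (n : ℕ) (G : Graph n) (k : ℕ) → γ'MBT≡ G k → k ≤ ⌊ n /2⌋
γ'MBT≤⌊n/2⌋ n G k γ =
  least≤ γ (STurn-half G k n {F = ⊤} (λ _ _ → ∈⊤) (≤-reflexive (∣⊤∣≡n n)) (proj₁ γ))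

-- Total domination as a lower bound

Dominates : Graph n → Subset n → Fin n → Set
Dominates {n} G s v = Σ (Fin n) λ u → Adj G v u × u ∈ s

∣p∪q∣≤∣p∣+∣q∣ : (p q : Subset n) → ∣ p ∪ q ∣ ≤ ∣ p ∣ + ∣ q ∣
∣p∪q∣≤∣p∣+∣q∣ [] [] = z≤n
∣p∪q∣≤∣p∣+∣q∣ (outside ∷ p) (outside ∷ q) = ∣p∪q∣≤∣p∣+∣q∣ p q
∣p∪q∣≤∣p∣+∣q∣ (outside ∷ p) (inside  ∷ q) =
  ≤-trans (s≤s (∣p∪q∣≤∣p∣+∣q∣ p q)) (≤-reflexive (≡-sym (+-suc ∣ p ∣ ∣ q ∣)))
∣p∪q∣≤∣p∣+∣q∣ (inside  ∷ p) (y ∷ q) =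
  s≤s (≤-trans (∣p∪q∣≤∣p∣+∣q∣ p q) (+-monoʳ-≤ ∣ p ∣ (∣p∣≤∣x∷p∣ y q)))

Dom⊆ : Position n → Subset n → Set
Dom⊆ {n} p s = (u : Fin n) → p u ≡ dom → u ∈ s

DominatingSet≤ : Graph n → ℕ → Set
DominatingSet≤ {n} G m = Σ (Subset n) λ s → ((v : Fin n) → Dominates G s v) × ∣ s ∣ ≤ m

-- One play following the winning strategy suffices: each move of Dominator adds at most one vertex
-- to `s`, and the set present at his win is totally dominating.
DTurn⇒dominating : (G : Graph n) (k : ℕ) {p : Position n} {s : Subset n} →
                   Dom⊆ p s → DTurn G k p → DominatingSet≤ G (k + ∣ s ∣)
STurn⇒dominating : (G : Graph n) (k : ℕ) {p : Position n} {s : Subset n} →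
                   Dom⊆ p s → STurn G k p → DominatingSet≤ G (k + ∣ s ∣)
TotDom⇒dominating : (G : Graph n) (k : ℕ) {p : Position n} {s : Subset n} →
                    Dom⊆ p s → TotDom G p → DominatingSet≤ G (k + ∣ s ∣)
TotDom⇒dominating G k {s = s} s⊇ td =
  s , (λ v → let u , vu , pu = td v in u , vu , s⊇ u pu) , m≤n+m ∣ s ∣ k
DTurn⇒dominating G zero    s⊇ td = TotDom⇒dominating G zero s⊇ td
DTurn⇒dominating G (suc k) s⊇ (inj₁ td) = TotDom⇒dominating G (suc k) s⊇ td
DTurn⇒dominating G (suc k) {p} {s} s⊇ (inj₂ (v , _ , st)) =
  let t , dt , ∣t∣≤ = STurn⇒dominating G k s∪v⊇ st in t , dt , ≤-trans ∣t∣≤ bound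
  where
  open ≤-Reasoning
  s∪v⊇ : Dom⊆ (update p v dom) (s ∪ ⁅ v ⁆)
  s∪v⊇ u eq with update⁻ p v dom u eq
  ... | inj₁ (refl , _) = x∈p∪q⁺ {p = s} (inj₂ (x∈⁅x⁆ v))
  ... | inj₂ (_ , pu)   = x∈p∪q⁺ (inj₁ (s⊇ u pu))
  bound : k + ∣ s ∪ ⁅ v ⁆ ∣ ≤ suc k + ∣ s ∣
  bound = begin
    k + ∣ s ∪ ⁅ v ⁆ ∣       ≤⟨ +-monoʳ-≤ k (∣p∪q∣≤∣p∣+∣q∣ s ⁅ v ⁆) ⟩
    k + (∣ s ∣ + ∣ ⁅ v ⁆ ∣) ≡⟨ cong (λ x → k + (∣ s ∣ + x)) (∣⁅x⁆∣≡1 v) ⟩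
    k + (∣ s ∣ + 1)         ≡⟨ cong (k +_) (+-comm ∣ s ∣ 1) ⟩
    k + suc ∣ s ∣           ≡⟨ +-suc k ∣ s ∣ ⟩
    suc k + ∣ s ∣           ∎
STurn⇒dominating G k s⊇ (inj₁ td) = TotDom⇒dominating G k s⊇ td
-- Any move of Staller will do, so she takes the free vertex that `STurn` supplies.
STurn⇒dominating G k {p} {s} s⊇ (inj₂ ((v , fv) , d)) = DTurn⇒dominating G k s⊇′ (d v fv)
  where
  s⊇′ : Dom⊆ (update p v stal) s
  s⊇′ u eq with update⁻ p v stal u eq
  ... | inj₂ (_ , pu) = s⊇ u pu

-- Pairing strategies

Pairs : ℕ → Set
Pairs n = List (Fin n × Fin n)

vertices : Pairs n → List (Fin n)
vertices []            = []
vertices ((x , y) ∷ L) = x ∷ y ∷ vertices L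

vertices-↭ : {L L′ : Pairs n} → L ↭ L′ → vertices L ↭ vertices L′
vertices-↭ refl        = refl
vertices-↭ (prep _ r)  = prep _ (prep _ (vertices-↭ r))
vertices-↭ (trans r s) = trans (vertices-↭ r) (vertices-↭ s)
vertices-↭ (swap {xs} {ys} (a , b) (c , d) r) = begin
  a ∷ b ∷ c ∷ d ∷ vertices xs ↭⟨ prep a (swap b c refl) ⟩
  a ∷ c ∷ b ∷ d ∷ vertices xs ↭⟨ swap a c (swap b d (vertices-↭ r)) ⟩
  c ∷ a ∷ d ∷ b ∷ vertices ys ↭⟨ prep c (swap a d refl) ⟩
  c ∷ d ∷ a ∷ b ∷ vertices ys ∎
  where open PermutationReasoning

Unique-resp-↭ : {xs ys : List (Fin n)} → xs ↭ ys → Unique xs → Unique ys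
Unique-resp-↭ r = Permutationₛ.Unique-resp-↭ (setoid _) (↭⇒↭ₛ r)

-- Brings to the front a pair that Dominator can spend on Staller's move v:
-- the one containing v if there is one, any pair otherwise.
select : (v : Fin n) (q : Fin n × Fin n) (L : Pairs n) → Unique (vertices (q ∷ L)) →
         Σ (Fin n × Fin n) λ q′ → Σ (Pairs n) λ L′ → q ∷ L ↭ q′ ∷ L′ × All (_≢ v) (vertices L′)
select v q [] _ = q , [] , refl , []
select v (x , y) (q ∷ L) (x≢ ∷ y≢ ∷ u) with v ≟ x | v ≟ y
... | yes refl | _        = (x , y) , q ∷ L , refl , All.map (_∘ ≡-sym) (All.tail x≢)
... | no _     | yes refl = (x , y) , q ∷ L , refl , All.map (_∘ ≡-sym) y≢
... | no v≢x   | no v≢y   =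
  let q′ , L′ , r , v∉ = select v q L u in
  q′ , (x , y) ∷ L′ , trans (prep _ r) (swap _ _ refl) , (v≢x ∘ ≡-sym) ∷ (v≢y ∘ ≡-sym) ∷ v∉

Dominated : Graph n → Position n → Fin n → Set
Dominated {n} G p v = Σ (Fin n) λ u → Adj G v u × p u ≡ dom

PairIn : Graph n → Fin n → Fin n × Fin n → Set
PairIn G v (x , y) = Adj G v x × Adj G v y

Dominated-update : (G : Graph n) {p : Position n} {w : Fin n} {o : Owner} {v : Fin n} →
                   p w ≡ free → Dominated G p v → Dominated G (update p w o) v
Dominated-update _ {p = p} {o = o} fw (u , vu , pu) =
  u , vu , ≡-trans (update-≢ p o (distinct pu fw (λ ()))) pu

All-free-update : {p : Position n} {v : Fin n} {o : Owner} {xs : List (Fin n)} →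
                  All (_≢ v) xs → All (λ x → p x ≡ free) xs → All (λ x → update p v o x ≡ free) xs
All-free-update {p = p} {o = o} ≢v fs =
  All.zipWith (λ (x≢v , fx) → ≡-trans (update-≢ p o x≢v) fx) (≢v , fs)

-- The invariant is that the pairs are disjoint and free, and that each vertex is dominated or has a
-- pair inside its neighbourhood. A move of Staller meets at most one pair; Dominator answers in
-- that pair, or in any pair if she met none, and the pair is discarded. When no pair is left, the
-- invariant says that he has won.
pairing-strategy : (G : Graph n) (k : ℕ) (L : Pairs n) (p : Position n) → length L ≡ k →
                   Unique (vertices L) → All (λ x → p x ≡ free) (vertices L) →
                   ((v : Fin n) → Dominated G p v ⊎ Any (PairIn G v) L) → STurn G k p
pairing-strategy G k [] p _ _ _ cover = inj₁ (λ v → fromInj₁ (λ ()) (cover v))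
pairing-strategy {n} G (suc k) ((a , b) ∷ L) p len uniq frees@(fa ∷ _) cover =
  inj₂ ((a , fa) , respond)
  where
  respond : (v : Fin n) → p v ≡ free → DTurn G (suc k) (update p v stal)
  respond v fv with select v (a , b) L uniq
  ... | (x , y) , L′ , r , ≢v
    with Unique-resp-↭ (vertices-↭ r) uniq | All-resp-↭ (vertices-↭ r) frees
  ...   | (x≢y ∷ x≢) ∷ y≢ ∷ uniq′ | fx ∷ fy ∷ free′ = reply
    where
    -- Here `w` is a vertex of the selected pair that Staller has not taken; it dominates every
    -- vertex that relied on this pair.
    take : (w : Fin n) → w ≢ v → p w ≡ free → All (_≢ w) (vertices L′) →
           ({u : Fin n} → PairIn G u (x , y) → Adj G u w) → DTurn G (suc k) (update p v stal)
    take w w≢v fw ≢w uw = inj₂ (w , fw′ , pairing-strategy G k L′ (update (update p v stal) w dom)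
      (suc-injective (≡-trans (≡-sym (↭-length r)) len)) uniq′
      (All-free-update ≢w (All-free-update ≢v free′)) cover′)
      where
      fw′ : update p v stal w ≡ free
      fw′ = ≡-trans (update-≢ p stal w≢v) fw
      cover′ : (u : Fin n) → Dominated G (update (update p v stal) w dom) u ⊎ Any (PairIn G u) L′
      cover′ u with cover u
      ... | inj₁ d = inj₁ (Dominated-update G fw′ (Dominated-update G fv d))
      ... | inj₂ e with Any-resp-↭ r e
      ...   | here q   = inj₁ (w , uw q , update-≡ (update p v stal) w dom)
      ...   | there e′ = inj₂ e′
    reply : DTurn G (suc k) (update p v stal)
    -- The vertex `x` serves unless Staller has just taken it; then `y` is still free.
    reply with x ≟ v
    ... | no x≢v   = take x x≢v fx (All.map (_∘ ≡-sym) x≢) proj₁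
    ... | yes refl = take y (x≢y ∘ ≡-sym) fy (All.map (_∘ ≡-sym) y≢) proj₂

-- Extremal graphs

-- Dominator plays the openers and then follows the pairing. The root is exempt
-- from domination in the lower bound, so that it may receive further neighbours.
record Extremal (openings n k : ℕ) : Set₁ where
  field
    graph       : Graph n
    root        : Fin n
    reach       : (v : Fin n) → Reach graph v root
    openers     : List (Fin n)
    pairs       : Pairs n
    #openers    : length openers ≡ openings
    #moves      : openings + length pairs ≡ k
    unique      : Unique (openers ++ vertices pairs)
    cover       : (v : Fin n) → Any (Adj graph v) openers ⊎ Any (PairIn graph v) pairs
    lower-bound : (s : Subset n) → ((v : Fin n) → v ≢ root → Dominates graph s v) → k ≤ ∣ s ∣

Reach-trans : {G : Graph n} {u v w : Fin n} → Reach G u v → Reach G v w → Reach G u w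
Reach-trans here       r = r
Reach-trans (step e q) r = step e (Reach-trans q r)

Reach-sym : {G : Graph n} {u v : Fin n} → Reach G u v → Reach G v u
Reach-sym         here       = here
Reach-sym {G = G} (step e r) = Reach-trans (Reach-sym r) (step (sym G e) here)

module _ {o n k : ℕ} (E : Extremal o n k) where
  open Extremal E

  connected : Connected graph
  connected u v = Reach-trans (reach u) (Reach-sym (reach v))

  -- The summand `∣ ⊥ ∣`, which is 0, is the form produced by following a play from `start`, where
  -- Dominator owns nothing.
  too-small : {j : ℕ} → j < k → ¬ DominatingSet≤ graph (j + ∣ ⊥ {n} ∣)
  too-small {j} j<k (s , ds , ∣s∣≤) = <⇒≱ j<k (≤-trans (lower-bound s (λ v _ → ds v))
    (≤-trans ∣s∣≤ (≤-reflexive (≡-trans (cong (j +_) (∣⊥∣≡0 n)) (+-identityʳ j)))))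

extremal-γ' : {n k : ℕ} (E : Extremal 0 n k) → γ'MBT≡ (Extremal.graph E) k
extremal-γ' {k = k} E
  with Extremal.openers E | Extremal.#openers E | Extremal.unique E | Extremal.cover E
... | [] | refl | uniq | cov =
  pairing-strategy graph k pairs start #moves uniq (All.tabulate (λ _ → refl))
    (λ v → inj₂ ([ (λ ()) , id ]′ (cov v))) ,
  λ j j<k win → too-small E j<k (STurn⇒dominating graph j {s = ⊥} (λ _ ()) win)
  where open Extremal E

extremal-γ : {n k : ℕ} (E : Extremal 1 n k) → γMBT≡ (Extremal.graph E) k
extremal-γ E
  with Extremal.openers E | Extremal.#openers E | Extremal.unique E | Extremal.cover E
... | s ∷ [] | refl | s≢ ∷ uniq | cov =
  -- Writing `k` as `1 + length pairs` lets `DTurn` unfold, so that the opener can be played first.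
  subst (λ j → DTurn graph j start) #moves (inj₂ (s , refl ,
    pairing-strategy graph (length pairs) pairs (update start s dom) refl uniq
      (All-free-update {p = start} (All.map (_∘ ≡-sym) s≢) (All.tabulate (λ _ → refl)))
      (λ v → ⊎-map₁ (λ { (here vs) → s , vs , update-≡ start s dom }) (cov v)))) ,
  λ j j<k win → too-small E j<k (DTurn⇒dominating graph j {s = ⊥} (λ _ ()) win)
  where open Extremal E

-- Concrete graphs checked by evaluation

module Neighbourhoods (N : Fin n → List (Fin n)) where
  open import Data.List.Membership.DecPropositional (_≟_ {n}) using () renaming (_∈?_ to _∈ₗ?_)
  open import Data.List.Relation.Unary.Unique.DecPropositional (_≟_ {n}) using (unique?)

  Covers : List (Fin n) → Pairs n → Set
  Covers S L = (v : Fin n) →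
    Any (_∈ₗ N v) S ⊎ Any (λ q → proj₁ q ∈ₗ N v × proj₂ q ∈ₗ N v) L

  covers? : (S : List (Fin n)) (L : Pairs n) → Dec (Covers S L)
  covers? S L = all? λ v →
    Any.any? (_∈ₗ? N v) S ⊎-dec Any.any? (λ q → (proj₁ q ∈ₗ? N v) ×-dec (proj₂ q ∈ₗ? N v)) L

  -- A counterexample to `lower-bound`; being decidable, it can be excluded by searching all
  -- subsets.
  TooSmall : ℕ → Fin n → Subset n → Set
  TooSmall k root s = ∣ s ∣ < k × ((v : Fin n) → v ≢ root → Σ (Fin n) λ u → u ∈ₗ N v × u ∈ s)

  tooSmall? : (k : ℕ) (root : Fin n) (s : Subset n) → Dec (TooSmall k root s)
  tooSmall? k root s = (∣ s ∣ <? k) ×-dec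
    all? λ v → ¬? (v ≟ root) →-dec any? λ u → (u ∈ₗ? N v) ×-dec (u ∈? s)

  neighbourGraph : True (all? λ u → all? λ v → (v ∈ₗ? N u) →-dec (u ∈ₗ? N v)) →
                   True (all? λ v → ¬? (v ∈ₗ? N v)) → Graph n
  neighbourGraph s i = record
    { Adj    = λ u v → v ∈ₗ N u
    ; sym    = λ {u} {v} → toWitness s u v
    ; irrefl = λ {v} → toWitness i v
    }

  edge : {s : _} {i : _} {w : Fin n} (u v : Fin n) {_ : True (v ∈ₗ? N u)} →
         Reach (neighbourGraph s i) v w → Reach (neighbourGraph s i) u w
  edge u v {e} = step (toWitness e)

  -- For concrete data the `True` and `False` arguments evaluate to the unit type, so `_` fills them
  -- in.
  extremal : {s : _} {i : _} (root : Fin n) (S : List (Fin n)) (L : Pairs n) →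
             ((v : Fin n) → Reach (neighbourGraph s i) v root) →
             True (unique? (S ++ vertices L)) → True (covers? S L) →
             False (anySubset? (tooSmall? (length S + length L) root)) →
             Extremal (length S) n (length S + length L)
  extremal {s} {i} root S L reach u c l = record
    { graph       = neighbourGraph s i
    ; root        = root
    ; reach       = reach
    ; openers     = S
    ; pairs       = L
    ; #openers    = refl
    ; #moves      = refl
    ; unique      = toWitness u
    ; cover       = toWitness c
    ; lower-bound = λ t dt → ≮⇒≥ (λ lt → toWitnessFalse l (t , lt , dt))
    }

-- Base graphs

module Square where
  -- The cycle 0 2 1 3. Each of the pairs 0, 1 and 2, 3 is the whole neighbourhood of both vertices
  -- of the other. The root 0 has the same neighbours as 1, so exempting it costs nothing.
  N : Fin 4 → List (Fin 4)
  N 0F = 2F ∷ 3F ∷ []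
  N 1F = 2F ∷ 3F ∷ []
  N 2F = 0F ∷ 1F ∷ []
  N 3F = 0F ∷ 1F ∷ []
  open Neighbourhoods N public

  square : Graph 4
  square = neighbourGraph _ _

  reach : (v : Fin 4) → Reach square v 0F
  reach 0F = here
  reach 1F = edge 1F 2F (reach 2F)
  reach 2F = edge 2F 0F here
  reach 3F = edge 3F 0F here

  extremal₀ : Extremal 0 4 2
  extremal₀ = extremal 0F [] ((0F , 1F) ∷ (2F , 3F) ∷ []) reach _ _ _

  extremal₁ : Extremal 1 4 2
  extremal₁ = extremal 0F (2F ∷ []) ((0F , 1F) ∷ []) reach _ _ _

module Six where
  -- The 5-cycle 0 1 4 5 3, whose total domination number is 3, with a vertex 2 having the same
  -- neighbours as 1. This twin is the root, so its exemption costs nothing.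
  N : Fin 6 → List (Fin 6)
  N 0F = 1F ∷ 2F ∷ 3F ∷ []
  N 1F = 0F ∷ 4F ∷ []
  N 2F = 0F ∷ 4F ∷ []
  N 3F = 0F ∷ 5F ∷ []
  N 4F = 1F ∷ 2F ∷ 5F ∷ []
  N 5F = 3F ∷ 4F ∷ []
  open Neighbourhoods N

  reach : (v : Fin 6) → Reach (neighbourGraph _ _) v 2F
  reach 0F = edge 0F 2F here
  reach 1F = edge 1F 0F (reach 0F)
  reach 2F = here
  reach 3F = edge 3F 0F (reach 0F)
  reach 4F = edge 4F 2F here
  reach 5F = edge 5F 4F (reach 4F)

  extremal₁ : Extremal 1 6 3
  extremal₁ = extremal 2F (0F ∷ []) ((1F , 2F) ∷ (3F , 4F) ∷ []) reach _ _ _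

module Seven where
  -- The 5-cycle 0 2 5 6 4 with 3 a nonadjacent twin of 2 and 1 an adjacent twin of 0. The doubling
  -- supplies the pairs 0, 1 and 2, 3; the third pair 4, 5 is the neighbourhood of 6.
  N : Fin 7 → List (Fin 7)
  N 0F = 1F ∷ 2F ∷ 3F ∷ 4F ∷ []
  N 1F = 0F ∷ 2F ∷ 3F ∷ 4F ∷ []
  N 2F = 0F ∷ 1F ∷ 5F ∷ []
  N 3F = 0F ∷ 1F ∷ 5F ∷ []
  N 4F = 0F ∷ 1F ∷ 6F ∷ []
  N 5F = 2F ∷ 3F ∷ 6F ∷ []
  N 6F = 4F ∷ 5F ∷ []
  open Neighbourhoods N

  reach : (v : Fin 7) → Reach (neighbourGraph _ _) v 1F
  reach 0F = edge 0F 1F here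
  reach 1F = here
  reach 2F = edge 2F 1F here
  reach 3F = edge 3F 1F here
  reach 4F = edge 4F 1F here
  reach 5F = edge 5F 2F (reach 2F)
  reach 6F = edge 6F 4F (reach 4F)

  extremal₀ : Extremal 0 7 3
  extremal₀ = extremal 1F [] ((0F , 1F) ∷ (2F , 3F) ∷ (4F , 5F) ∷ []) reach _ _ _

-- Hanging a 4-cycle at the root

module Attach (G : Graph n) (r : Fin n) where
  open Square using (square)

  -- Since `splitAt 4 (4 ↑ʳ u)` computes to `inj₂ u`, adjacency of old vertices in `attached` is
  -- adjacency in `G` by definition.
  Adj⊎ : Fin 4 ⊎ Fin n → Fin 4 ⊎ Fin n → Set
  Adj⊎ (inj₁ i) (inj₁ j) = Adj square i j
  Adj⊎ (inj₁ i) (inj₂ v) = i ≡ 0F × v ≡ r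
  Adj⊎ (inj₂ u) (inj₁ j) = j ≡ 0F × u ≡ r
  Adj⊎ (inj₂ u) (inj₂ v) = Adj G u v

  Adj⊎-sym : (x y : Fin 4 ⊎ Fin n) → Adj⊎ x y → Adj⊎ y x
  Adj⊎-sym (inj₁ i) (inj₁ j) e = sym square {i} {j} e
  Adj⊎-sym (inj₁ _) (inj₂ _) e = e
  Adj⊎-sym (inj₂ _) (inj₁ _) e = e
  Adj⊎-sym (inj₂ _) (inj₂ _) e = sym G e

  Adj⊎-irrefl : (x : Fin 4 ⊎ Fin n) → ¬ Adj⊎ x x
  Adj⊎-irrefl (inj₁ i) = irrefl square {i}
  Adj⊎-irrefl (inj₂ _) = irrefl G

  attached : Graph (4 + n)
  attached = record
    { Adj    = λ u v → Adj⊎ (splitAt 4 u) (splitAt 4 v)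
    ; sym    = λ {u} {v} → Adj⊎-sym (splitAt 4 u) (splitAt 4 v)
    ; irrefl = λ {v} → Adj⊎-irrefl (splitAt 4 v)
    }

  reach-old : {u v : Fin n} → Reach G u v → Reach attached (4 ↑ʳ u) (4 ↑ʳ v)
  reach-old here       = here
  reach-old (step e p) = step e (reach-old p)

  reach-root : ((v : Fin n) → Reach G v r) → (v : Fin (4 + n)) → Reach attached v (4 ↑ʳ r)
  reach-root reach = λ where
      0F → r₀
      1F → step {w = 2F} (here refl) r₂
      2F → r₂
      3F → step {w = 0F} (here refl) r₀
      (suc (suc (suc (suc v)))) → reach-old (reach v)
    where
    r₀ : Reach attached 0F (4 ↑ʳ r)
    r₀ = step {w = 4 ↑ʳ r} (refl , refl) here
    r₂ : Reach attached 2F (4 ↑ʳ r)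
    r₂ = step {w = 0F} (here refl) r₀

  suc∣t∣≤ : {m : ℕ} {a b : Bool} (t : Subset m) → a ≡ inside ⊎ b ≡ inside → suc ∣ t ∣ ≤ ∣ a ∷ b ∷ t ∣
  suc∣t∣≤ {b = b} t (inj₁ refl) = s≤s (∣p∣≤∣x∷p∣ b t)
  suc∣t∣≤ {a = a} t (inj₂ refl) = ∣p∣≤∣x∷p∣ a (inside ∷ t)

  -- The neighbourhoods of the new vertices 1 and 2 are the disjoint sets 2, 3 and 0, 1, so `s` has
  -- two new vertices. Only `r` among the old vertices has a new neighbour, and `r` is exempt, so
  -- the old part `t` of `s` must dominate all the others and has size at least `k`.
  attached-lower : {k : ℕ} →
    ((s : Subset n) → ((v : Fin n) → v ≢ r → Dominates G s v) → k ≤ ∣ s ∣) →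
    (s : Subset (4 + n)) → ((v : Fin (4 + n)) → v ≢ 4 ↑ʳ r → Dominates attached s v) →
    2 + k ≤ ∣ s ∣
  attached-lower lower (a ∷ b ∷ c ∷ d ∷ t) ds =
    ≤-trans (s≤s (≤-trans (s≤s (lower t dt)) (suc∣t∣≤ t (cd (ds 1F λ ())))))
            (suc∣t∣≤ (c ∷ d ∷ t) (ab (ds 2F λ ())))
    where
    cd : Dominates attached (a ∷ b ∷ c ∷ d ∷ t) 1F → c ≡ inside ⊎ d ≡ inside
    cd (2F , _ , there (there here))         = inj₁ refl
    cd (3F , _ , there (there (there here))) = inj₂ refl
    cd (0F , here () , _)
    cd (0F , there (here ()) , _)
    cd (1F , here () , _)
    cd (1F , there (here ()) , _)
    cd (suc (suc (suc (suc _))) , (() , _) , _)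
    ab : Dominates attached (a ∷ b ∷ c ∷ d ∷ t) 2F → a ≡ inside ⊎ b ≡ inside
    ab (0F , _ , here)       = inj₁ refl
    ab (1F , _ , there here) = inj₂ refl
    ab (2F , here () , _)
    ab (2F , there (here ()) , _)
    ab (3F , here () , _)
    ab (3F , there (here ()) , _)
    ab (suc (suc (suc (suc _))) , (() , _) , _)
    dt : (v : Fin n) → v ≢ r → Dominates G t v
    dt v v≢r with ds (4 ↑ʳ v) (v≢r ∘ ↑ʳ-injective 4 v r)
    ... | 0F , (_ , v≡r) , _ = contradiction v≡r v≢r
    ... | suc (suc (suc (suc u))) , vu , there (there (there (there u∈t))) = u , vu , u∈t

-- The old openers and pairs still cover the old vertices, and the two pairs of the 4-cycle cover
-- the new ones. The root stays the same old vertex, so the construction can be iterated.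
attach : {o n k : ℕ} → Extremal o n k → Extremal o (4 + n) (2 + k)
attach {o} {n} {k} E = record
  { graph       = attached
  ; root        = 4 ↑ʳ root
  ; reach       = reach-root reach
  ; openers     = map (4 ↑ʳ_) openers
  ; pairs       = (0F , 1F) ∷ (2F , 3F) ∷ map old² pairs
  ; #openers    = ≡-trans (length-map (4 ↑ʳ_) openers) #openers
  ; #moves      = #moves′
  ; unique      = unique′
  ; cover       = cover′
  ; lower-bound = attached-lower lower-bound
  }
  where
  open Extremal E
  open Attach graph root
  old² : Fin n × Fin n → Fin (4 + n) × Fin (4 + n)
  old² (x , y) = 4 ↑ʳ x , 4 ↑ʳ y
  #moves′ : o + (2 + length (map old² pairs)) ≡ 2 + k
  #moves′ = ≡-trans (cong (λ l → o + (2 + l)) (length-map old² pairs))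
    (≡-trans (+-suc o _) (cong suc (≡-trans (+-suc o _) (cong suc #moves))))
  vertices-old² : (L : Pairs n) → map (4 ↑ʳ_) (vertices L) ≡ vertices (map old² L)
  vertices-old² []      = refl
  vertices-old² (_ ∷ L) = cong (λ xs → _ ∷ _ ∷ xs) (vertices-old² L)
  new : List (Fin (4 + n))
  new = 0F ∷ 1F ∷ 2F ∷ 3F ∷ []
  unique-new : (xs : List (Fin n)) → Unique xs → Unique (new ++ map (4 ↑ʳ_) xs)
  unique-new xs u =
    ((λ ()) ∷ (λ ()) ∷ (λ ()) ∷ old≢ (λ _ ())) ∷ ((λ ()) ∷ (λ ()) ∷ old≢ (λ _ ())) ∷
    ((λ ()) ∷ old≢ (λ _ ())) ∷ old≢ (λ _ ()) ∷ Unique.map⁺ (↑ʳ-injective 4 _ _) u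
    where
    old≢ : {v : Fin (4 + n)} → ((x : Fin n) → v ≢ 4 ↑ʳ x) → All (v ≢_) (map (4 ↑ʳ_) xs)
    old≢ ≢old = All.map⁺ (All.universal ≢old xs)
  unique′ : Unique (map (4 ↑ʳ_) openers ++ new ++ vertices (map old² pairs))
  -- Distinctness is proved with the new vertices in front; `shifts` then moves the openers before
  -- them.
  unique′ = Unique-resp-↭ (shifts new (map (4 ↑ʳ_) openers))
    (subst (λ xs → Unique (new ++ xs))
      (≡-trans (map-++ (4 ↑ʳ_) openers _) (cong (map (4 ↑ʳ_) openers ++_) (vertices-old² pairs)))
      (unique-new _ unique))
  cover′ : (v : Fin (4 + n)) → Any (Adj attached v) (map (4 ↑ʳ_) openers) ⊎
           Any (PairIn attached v) ((0F , 1F) ∷ (2F , 3F) ∷ map old² pairs)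
  -- The pair 2, 3 covers the vertices 0 and 1, and the pair 0, 1 covers 2 and 3.
  cover′ 0F = inj₂ (there (here (here refl , there (here refl))))
  cover′ 1F = inj₂ (there (here (here refl , there (here refl))))
  cover′ 2F = inj₂ (here (here refl , there (here refl)))
  cover′ 3F = inj₂ (here (here refl , there (here refl)))
  cover′ (suc (suc (suc (suc v)))) =
    ⊎-map Any.map⁺ (λ e → there (there (Any.map⁺ e))) (cover v)

-- Sharpness for every value above 1

-- Attaching raises the value by 2 and the order by 4, so equality with half the order persists; one
-- base graph for each parity of the value is enough. The offset 2 encodes the condition that the
-- value exceeds 1.
extremal₁ : (k : ℕ) → Σ ℕ λ n → Extremal 1 n (2 + k) × 2 + k ≡ ⌈ n /2⌉
extremal₁ 0 = 4 , Square.extremal₁ , refl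
extremal₁ 1 = 6 , Six.extremal₁ , refl
extremal₁ (suc (suc k)) = let n , E , eq = extremal₁ k in 4 + n , attach E , cong (2 +_) eq

extremal₀ : (k : ℕ) → Σ ℕ λ n → Extremal 0 n (2 + k) × 2 + k ≡ ⌊ n /2⌋
extremal₀ 0 = 4 , Square.extremal₀ , refl
extremal₀ 1 = 7 , Seven.extremal₀ , refl
extremal₀ (suc (suc k)) = let n , E , eq = extremal₀ k in 4 + n , attach E , cong (2 +_) eq

theorem2p1 : ((n : ℕ) (G : Graph n) (k : ℕ) → γMBT≡ G k → k ≤ ⌈ n /2⌉)
    × ((n : ℕ) (G : Graph n) (k : ℕ) → γ'MBT≡ G k → k ≤ ⌊ n /2⌋)
    × ((k : ℕ) → 1 < k →
    Σ ℕ (λ n → Σ (Graph n) λ H → Connected H × γMBT≡ H k × k ≡ ⌈ n /2⌉))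
    × ((k : ℕ) → 1 < k →
    Σ ℕ (λ n → Σ (Graph n) λ H → Connected H × γ'MBT≡ H k × k ≡ ⌊ n /2⌋))
theorem2p1 = γMBT≤⌈n/2⌉ , γ'MBT≤⌊n/2⌋ ,
  (λ { (suc (suc k)) (s≤s (s≤s z≤n)) → let n , E , eq = extremal₁ k in
       n , Extremal.graph E , connected E , extremal-γ E , eq }) ,
  (λ { (suc (suc k)) (s≤s (s≤s z≤n)) → let n , E , eq = extremal₀ k in
       n , Extremal.graph E , connected E , extremal-γ' E , eq })
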